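{- If a cube $A\in\mathcal{C}^3_3(v,k,\lambda)$ exists and $k>1$, then $$\lambda(v-1)\le k(k-1)-1 .$$
   Context: A $v\times v\times v$ array is a function on $\{1,\dots,v\}^3$. A layer is a 2-dimensional subarray obtained by fixing one of the three coordinates. Two layers are parallel if they fix the same coordinate, to different values; their scalar product is the sum over all positions of the product of corresponding entries. $\mathcal{C}^3_3(v,k,\lambda)$ is the set of $v\times v\times v$ arrays over $\{0,1\}$ such that every layer (in each of the three directions) contains exactly $k$ ones and every two parallel layers have scalar product $\lambda$. -}

module Defs where

open import Data.Bool.Base using (if_then_else_)
open import Data.Fin.Base using (Fin; toℕ)
open import Data.Fin.Patterns using (0F; 1F; 2F)
open import Data.Fin.Properties using (_≟_)
open import Data.Nat.Base using (ℕ; _*_)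
open import Data.Nat.Properties using (+-*-semiring)
open import Relation.Binary.PropositionalEquality.Core using (_≡_; _≢_)
open import Relation.Nullary.Decidable.Core using (does)
open import Algebra.Properties.Semiring.Sum +-*-semiring using (sum)

Array₂ : ℕ → Set
Array₂ v = Fin v → Fin v → Fin 2

Array₃ : ℕ → Set
Array₃ v = Fin v → Fin v → Fin v → Fin 2

-- `layer A d a` fixes coordinate number d at the value a; the two remaining
-- coordinates keep their order.
layer : ∀ {v} → Array₃ v → Fin 3 → Fin v → Array₂ v
layer A 0F a = λ y z → A a y z
layer A 1F a = λ x z → A x a z
layer A 2F a = λ x y → A x y a

ones : ∀ {v} → Array₂ v → ℕ
ones L = sum λ i → sum λ j → if does (L i j ≟ 1F) then 1 else 0

infixl 7 _·_

_·_ : ∀ {v} → Array₂ v → Array₂ v → ℕ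
L · M = sum λ i → sum λ j → toℕ (L i j) * toℕ (M i j)

-- λ is a reserved word, so the common scalar product is written ƛ.
record 𝒞³₃ (v k ƛ : ℕ) : Set where
  field
    array         : Array₃ v
    layer-ones    : ∀ d a → ones (layer array d a) ≡ k
    layer-product : ∀ d {a b} → a ≢ b → layer array d a · layer array d b ≡ ƛ

{-# OPTIONS --safe #-}
-- Through a one at (x, y, z) pass a line in direction 0 and a line in
-- direction 1; both lie in the layer fixing the third coordinate at z and they
-- meet in one cell, so together they contain at most k + 1 < 2k ones.  Hence
-- one of them, say the one in direction d, has fewer than k ones.  Let L be the
-- layer in direction d through the chosen one.  Adding up the scalar products
-- of L with all v layers parallel to it gives k + λ(v − 1), and also the sum,
-- over the k ones of L, of the number of ones on the line in direction d
-- through it.  Every such number is at most k and one of them is smaller,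
-- so k + λ(v − 1) < k².
module Submission where

open import Defs
open import Data.Nat.Base using (ℕ; _>_)
open import Data.Integer.Base using (+_; _*_; _-_; _≤_)

open import Data.Bool.Base using (if_then_else_)
open import Data.Fin.Base using (Fin; zero; suc; toℕ; punchIn)
open import Data.Fin.Patterns using (0F; 1F; 2F)
open import Data.Fin.Properties using (_≟_; punchInᵢ≢i)
import Data.Integer.Base as ℤ
import Data.Integer.Properties as ℤ
open import Data.Nat.Base as ℕ using (zero; suc; z≤n; s≤s; z<s; _+_; _<_)
import Data.Nat.Properties as ℕ
open import Data.Nat.Properties using (+-*-semiring; module ≤-Reasoning)
open import Data.Product.Base using (∃; ∃₂; _,_)
open import Data.Vec.Functional using (removeAt)
open import Function.Base using (_∘_)
open import Relation.Binary.PropositionalEquality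
  using (_≡_; _≢_; refl; sym; trans; cong; cong₂; subst; subst₂; module ≡-Reasoning)
open import Relation.Nullary using (yes; no; does)
open import Algebra.Properties.Semiring.Sum +-*-semiring
  using (sum; sum-cong-≗; sum-remove; ∑-comm; *-distribˡ-sum; *-distribʳ-sum)

-- Sums of natural numbers

sum-mono-≤ : ∀ {n} {f g : Fin n → ℕ} → (∀ i → f i ℕ.≤ g i) → sum f ℕ.≤ sum g
sum-mono-≤ {zero}  f≤g = z≤n
sum-mono-≤ {suc n} f≤g = ℕ.+-mono-≤ (f≤g zero) (sum-mono-≤ (f≤g ∘ suc))

sum-const : ∀ n x → sum {n} (λ _ → x) ≡ n ℕ.* x
sum-const zero    x = refl
sum-const (suc n) x = cong (_+_ x) (sum-const n x)

-- The excess of sum g over sum f is at least that of g i over f i, with both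
-- sides moved so that no subtraction occurs.
sum-excess : ∀ {n} {f g : Fin n → ℕ} → (∀ i → f i ℕ.≤ g i) → ∀ i →
  sum f + g i ℕ.≤ sum g + f i
sum-excess {suc n} {f} {g} f≤g i = begin
  sum f + g i                       ≡⟨ cong (_+ g i) (sum-remove f) ⟩
  f i + sum (removeAt f i) + g i    ≤⟨ ℕ.+-monoˡ-≤ (g i) (ℕ.+-monoʳ-≤ (f i) (sum-mono-≤ (f≤g ∘ punchIn i))) ⟩
  f i + sum (removeAt g i) + g i    ≡⟨ ℕ.+-comm _ (g i) ⟩
  g i + (f i + sum (removeAt g i))  ≡⟨ cong (_+_ (g i)) (ℕ.+-comm (f i) _) ⟩
  g i + (sum (removeAt g i) + f i)  ≡⟨ ℕ.+-assoc (g i) _ (f i) ⟨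
  g i + sum (removeAt g i) + f i    ≡⟨ cong (_+ f i) (sum-remove g) ⟨
  sum g + f i                       ∎
  where open ≤-Reasoning

sum-mono-< : ∀ {n} {f g : Fin n → ℕ} → (∀ i → f i ℕ.≤ g i) →
  ∀ i → f i < g i → sum f < sum g
sum-mono-< {f = f} {g} f≤g i fi<gi = ℕ.+-cancelʳ-< (f i) (sum f) (sum g)
  (ℕ.<-≤-trans (ℕ.+-monoʳ-< (sum f) fi<gi) (sum-excess f≤g i))

lookup≤sum : ∀ {n} (f : Fin n → ℕ) i → f i ℕ.≤ sum f
lookup≤sum {suc n} f i = subst (f i ℕ.≤_) (sym (sum-remove f)) (ℕ.m≤m+n (f i) _)

sum>0⇒∃>0 : ∀ {n} (f : Fin n → ℕ) → sum f > 0 → ∃ λ i → f i > 0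
sum>0⇒∃>0 {suc n} f sum>0 with f zero in eq
... | suc m = zero , subst (_> 0) (sym eq) z<s
... | zero  with i , fi>0 ← sum>0⇒∃>0 (f ∘ suc) sum>0 = suc i , fi>0

-- `sum-excess` compares the entries of column `j` with the totals of their rows: row `i` and column
-- `j` overlap only in `f i j`.
row+column≤total : ∀ {m n} (f : Fin m → Fin n → ℕ) i j →
  sum (λ i′ → f i′ j) + sum (f i) ℕ.≤ sum (λ i′ → sum (f i′)) + f i j
row+column≤total f i j = sum-excess (λ i′ → lookup≤sum (f i′) j) i

-- Arrays

bit : (b : Fin 2) → (if does (b ≟ 1F) then 1 else 0) ≡ toℕ b
bit 0F = refl
bit 1F = refl

bit>0⇒≡1 : (b : Fin 2) → toℕ b > 0 → toℕ b ≡ 1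
bit>0⇒≡1 1F _ = refl

bit*bit : (b : Fin 2) → toℕ b ℕ.* toℕ b ≡ toℕ b
bit*bit 0F = refl
bit*bit 1F = refl

ones≡sum : ∀ {v} (L : Array₂ v) → ones L ≡ sum λ i → sum λ j → toℕ (L i j)
ones≡sum L = sum-cong-≗ λ i → sum-cong-≗ λ j → bit (L i j)

L·L≡ones : ∀ {v} (L : Array₂ v) → L · L ≡ ones L
L·L≡ones L = trans (sum-cong-≗ λ i → sum-cong-≗ λ j → bit*bit (L i j)) (sym (ones≡sum L))

ones>0⇒∃1 : ∀ {v} (L : Array₂ v) → ones L > 0 → ∃₂ λ i j → toℕ (L i j) ≡ 1
ones>0⇒∃1 L ones>0
  with i , row>0 ← sum>0⇒∃>0 _ (subst (_> 0) (ones≡sum L) ones>0)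
  with j , Lij>0 ← sum>0⇒∃>0 _ row>0 = i , j , bit>0⇒≡1 (L i j) Lij>0

module _ {v} (M : Fin v → Array₂ v) where

  -- `M` stands for all layers in one direction, so the sum runs along a line crossing them.
  line : Fin v → Fin v → ℕ
  line i j = sum λ b → toℕ (M b i j)

  sum-products : (L : Array₂ v) →
    sum (λ b → L · M b) ≡ sum λ i → sum λ j → toℕ (L i j) ℕ.* line i j
  sum-products L = begin
    (sum λ b → sum λ i → sum λ j → toℕ (L i j) ℕ.* toℕ (M b i j))
      ≡⟨ ∑-comm (λ b i → sum λ j → toℕ (L i j) ℕ.* toℕ (M b i j)) ⟩
    (sum λ i → sum λ b → sum λ j → toℕ (L i j) ℕ.* toℕ (M b i j))
      ≡⟨ sum-cong-≗ (λ i → ∑-comm λ b j → toℕ (L i j) ℕ.* toℕ (M b i j)) ⟩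
    (sum λ i → sum λ j → sum λ b → toℕ (L i j) ℕ.* toℕ (M b i j))
      ≡⟨ sum-cong-≗ (λ i → sum-cong-≗ λ j → *-distribˡ-sum (toℕ (L i j)) λ b → toℕ (M b i j)) ⟨
    (sum λ i → sum λ j → toℕ (L i j) ℕ.* line i j) ∎
    where open ≡-Reasoning

  -- Raising every line count to `k` gives `k` times the number of ones of `L`. The short line has
  -- weight 1, so its deficit survives and the inequality is strict.
  weighted-lines< : ∀ {k} (L : Array₂ v) → ones L ≡ k → (∀ i j → line i j ℕ.≤ k) →
    ∀ i j → toℕ (L i j) ≡ 1 → line i j < k →
    (sum λ i → sum λ j → toℕ (L i j) ℕ.* line i j) < k ℕ.* k
  weighted-lines< {k} L ones≡k line≤k i j Lij≡1 line<k = begin-strict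
    (sum λ i → sum λ j → toℕ (L i j) ℕ.* line i j)
      <⟨ sum-mono-< (λ i → sum-mono-≤ (entry≤ i)) i (sum-mono-< (entry≤ i) j entry<) ⟩
    (sum λ i → sum λ j → toℕ (L i j) ℕ.* k)
      ≡⟨ sum-cong-≗ (λ i → *-distribʳ-sum k λ j → toℕ (L i j)) ⟨
    (sum λ i → (sum λ j → toℕ (L i j)) ℕ.* k)
      ≡⟨ *-distribʳ-sum k (λ i → sum λ j → toℕ (L i j)) ⟨
    (sum λ i → sum λ j → toℕ (L i j)) ℕ.* k
      ≡⟨ cong (ℕ._* k) (trans (sym (ones≡sum L)) ones≡k) ⟩
    k ℕ.* k ∎
    where
    open ≤-Reasoning
    entry≤ : ∀ i j → toℕ (L i j) ℕ.* line i j ℕ.≤ toℕ (L i j) ℕ.* k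
    entry≤ i j = ℕ.*-monoʳ-≤ (toℕ (L i j)) (line≤k i j)
    entry< : toℕ (L i j) ℕ.* line i j < toℕ (L i j) ℕ.* k
    entry< rewrite Lij≡1 = ℕ.*-monoʳ-< 1 line<k

sum-layer-products : ∀ {n k ƛ} (M : Fin (suc n) → Array₂ (suc n)) →
  (∀ a → ones (M a) ≡ k) → (∀ {a b} → a ≢ b → M a · M b ≡ ƛ) →
  ∀ a → sum (λ b → M a · M b) ≡ k + n ℕ.* ƛ
sum-layer-products {n} {k} {ƛ} M ones≡k product≡ƛ a = begin
  sum (λ b → M a · M b)
    -- The product of `M a` with itself is split off; `punchIn a` enumerates the other `n` layers.
    ≡⟨ sum-remove (λ b → M a · M b) ⟩
  M a · M a + sum (λ b → M a · M (punchIn a b))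
    ≡⟨ cong₂ _+_ (trans (L·L≡ones (M a)) (ones≡k a))
                 (sum-cong-≗ λ b → product≡ƛ (punchInᵢ≢i a b ∘ sym)) ⟩
  k + sum {n} (λ _ → ƛ)
    ≡⟨ cong (_+_ k) (sum-const n ƛ) ⟩
  k + n ℕ.* ƛ ∎
  where open ≡-Reasoning

short-line-bound : ∀ {n k ƛ} (M : Fin (suc n) → Array₂ (suc n)) →
  (∀ a → ones (M a) ≡ k) → (∀ {a b} → a ≢ b → M a · M b ≡ ƛ) →
  (∀ i j → line M i j ℕ.≤ k) →
  ∀ a i j → toℕ (M a i j) ≡ 1 → line M i j < k → k + n ℕ.* ƛ < k ℕ.* k
short-line-bound {k = k} M ones≡k product≡ƛ line≤k a i j Maij≡1 line<k =
  subst (_< k ℕ.* k)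
    (trans (sym (sum-products M (M a))) (sum-layer-products M ones≡k product≡ƛ a))
    (weighted-lines< M (M a) (ones≡k a) line≤k i j Maij≡1 line<k)

k+n*ƛ<k*k : ∀ {n k ƛ} → 𝒞³₃ (suc n) k ƛ → k > 1 → k + n ℕ.* ƛ < k ℕ.* k
k+n*ƛ<k*k {n} {k} {ƛ} A k>1
  with x , y , one ← ones>0⇒∃1 (layer (𝒞³₃.array A) 2F zero)
                       (subst (_> 0) (sym (𝒞³₃.layer-ones A 2F zero)) (ℕ.<-trans z<s k>1))
  = bound
  where
  open 𝒞³₃ A
  M₀ M₁ : Fin (suc n) → Array₂ (suc n)
  M₀ = layer array 0F
  M₁ = layer array 1F

  layer-total : ∀ d a → (sum λ i → sum λ j → toℕ (layer array d a i j)) ≡ k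
  layer-total d a = trans (sym (ones≡sum (layer array d a))) (layer-ones d a)

  -- A line in direction 0 lies in a layer fixing coordinate 1, which has `k` ones.
  line₀≤k : ∀ y z → line M₀ y z ℕ.≤ k
  line₀≤k y z = subst (line M₀ y z ℕ.≤_) (layer-total 1F y)
    (sum-mono-≤ λ x → lookup≤sum (λ z → toℕ (array x y z)) z)

  line₁≤k : ∀ x z → line M₁ x z ℕ.≤ k
  line₁≤k x z = subst (line M₁ x z ℕ.≤_) (layer-total 0F x)
    (sum-mono-≤ λ y → lookup≤sum (λ z → toℕ (array x y z)) z)

  lines≤ : line M₀ y zero + line M₁ x zero ℕ.≤ k + 1
  lines≤ = subst₂ (λ t o → line M₀ y zero + line M₁ x zero ℕ.≤ t + o)
    (layer-total 2F zero) one
    (row+column≤total (λ x y → toℕ (array x y zero)) x y)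

  bound : k + n ℕ.* ƛ < k ℕ.* k
  bound with line M₀ y zero ℕ.<? k
  ... | yes line₀<k = short-line-bound M₀ (layer-ones 0F) (layer-product 0F) line₀≤k x y zero one line₀<k
  -- Since the first line has at least `k` ones, `lines≤` leaves at most 1 for the second, and
  -- `k > 1`.
  ... | no  line₀≮k = short-line-bound M₁ (layer-ones 1F) (layer-product 1F) line₁≤k y x zero one
    (ℕ.≤-<-trans
      (ℕ.+-cancelˡ-≤ k _ 1 (ℕ.≤-trans (ℕ.+-monoˡ-≤ _ (ℕ.≮⇒≥ line₀≮k)) lines≤))
      k>1)

proposition2p3 : ∀ (v k ƛ : ℕ) → (A : 𝒞³₃ v k ƛ) → k > 1 →
    + ƛ * (+ v - + 1) ≤ + k * (+ k - + 1) - + 1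
proposition2p3 _       (suc zero)    _       A (s≤s ())
-- For `v = 0` there are no layers and `ƛ` is arbitrary, but the left side is `-ƛ` and the right
-- side is nonnegative.
proposition2p3 zero    (suc (suc m)) zero    A k>1 = ℤ.+≤+ z≤n
proposition2p3 zero    (suc (suc m)) (suc ƛ) A k>1 = ℤ.-≤+
proposition2p3 (suc n) k@(suc (suc m)) ƛ   A k>1 =
  -- The strict inequality over ℕ supplies the `- + 1`: `k ℕ.* suc m` is a successor.
  subst (_≤ + k * + suc m - + 1) (ℤ.pos-* ƛ n) (ℤ.+≤+ (ℕ.s≤s⁻¹ ƛ*n<k*[k-1]))
  where
  ƛ*n<k*[k-1] : ƛ ℕ.* n < k ℕ.* suc m
  ƛ*n<k*[k-1] = subst (_< k ℕ.* suc m) (ℕ.*-comm n ƛ)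
    (ℕ.+-cancelˡ-< k _ _ (subst (k + n ℕ.* ƛ <_) (ℕ.*-suc k (suc m)) (k+n*ƛ<k*k A k>1)))
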